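{- Let $k$ be a positive integer. As formal power series, $$\widetilde{B}_k(x)\cdot\bigl(k+1-\widetilde{B}_k(x)\bigr)^k=(k+1)^{k+1}\cdot x.$$
   Context: A bridge of size $n$ (with respect to the line $y=x/k$) is a lattice path from $(0,0)$ to $(kn,n)$ composed only of unit steps to the right $(1,0)$ and up $(0,1)$. A minimal bridge is a nontrivial bridge (so of size $n\ge 1$) that contains no lattice points on the line $y=x/k$ other than its two endpoints. Let $\widetilde{b}_k(n)$ be the number of minimal bridges of size $n$ (so $\widetilde b_k(0)=0$), and let $\widetilde{B}_k(x)=\sum_{n\ge 1}\widetilde{b}_k(n)x^n$ be the ordinary generating function. -}

module Defs where

open import Algebra.Bundles.Raw using (RawRing)
import Algebra.Definitions.RawMonoid as RawMonoidDefinitions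
import Algebra.Definitions.RawSemiring as RawSemiringDefinitions
open import Data.Fin.Base using (toℕ)
open import Data.Integer.Base as ℤ using (ℤ; +_; 0ℤ; 1ℤ)
open import Data.List.Base using (List; []; _∷_; _++_; map; filter; length; foldl)
open import Data.List.Membership.Propositional using (_∈_)
open import Data.List.Membership.Propositional.Properties
  using (∈-map⁺; ∈-map⁻; ∈-++⁺ˡ; ∈-++⁺ʳ; ∈-filter⁺; ∈-filter⁻)
open import Data.List.Properties using (∷-injectiveʳ)
open import Data.List.Relation.Binary.Disjoint.Propositional using (Disjoint)
open import Data.List.Relation.Unary.All as All using (All)
import Data.List.Relation.Unary.AllPairs as AllPairs
open import Data.List.Relation.Unary.Any using (here)
open import Data.List.Relation.Unary.Unique.Propositional using (Unique)
import Data.List.Relation.Unary.Unique.Propositional.Properties as Unique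
open import Data.Nat.Base as ℕ using (ℕ; zero; suc)
import Data.Nat.Properties as ℕ
open import Data.Product.Base using (_×_; _,_; proj₁; proj₂)
open import Data.Product.Properties using (≡-dec)
open import Data.Sum.Base using (_⊎_)
open import Function.Bundles using (_⇔_; mk⇔)
open import Level using (0ℓ)
open import Relation.Binary.Definitions using (DecidableEquality)
open import Relation.Binary.PropositionalEquality
  using (_≡_; refl; sym; trans; cong; subst; _≗_)
open import Relation.Nullary.Decidable using (_×-dec_; _⊎-dec_; _→-dec_)
open import Relation.Unary using (Decidable)

Point : Set
Point = ℕ × ℕ

_≟ᴾ_ : DecidableEquality Point
_≟ᴾ_ = ≡-dec ℕ._≟_ ℕ._≟_

origin : Point
origin = 0 , 0

data Step : Set where
  right up : Step

move : Point → Step → Point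
move (x , y) right = suc x , y
move (x , y) up    = x , suc y

Path : Set
Path = List Step

endpoint : Point → Path → Point
endpoint = foldl move

points : Point → Path → List Point
points P []      = P ∷ []
points P (s ∷ p) = P ∷ points (move P s) p

-- The line y = x / k, with the denominator cleared.
OnLine : ℕ → Point → Set
OnLine k (x , y) = x ≡ k ℕ.* y

target : ℕ → ℕ → Point
target k n = k ℕ.* n , n

IsBridge : ℕ → ℕ → Path → Set
IsBridge k n p = endpoint origin p ≡ target k n

MeetsLineOnlyAtEnds : ℕ → ℕ → Path → Set
MeetsLineOnlyAtEnds k n p =
  All (λ P → OnLine k P → P ≡ origin ⊎ P ≡ target k n) (points origin p)

IsMinimalBridge : ℕ → ℕ → Path → Set
IsMinimalBridge k n p = 1 ℕ.≤ n × IsBridge k n p × MeetsLineOnlyAtEnds k n p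

isMinimalBridge? : ∀ k n → Decidable (IsMinimalBridge k n)
isMinimalBridge? k n p =
  1 ℕ.≤? n ×-dec
  endpoint origin p ≟ᴾ target k n ×-dec
  All.all? (λ (x , y) → x ℕ.≟ k ℕ.* y →-dec
              ((x , y) ≟ᴾ origin ⊎-dec (x , y) ≟ᴾ target k n))
           (points origin p)

pathsOfLength : ℕ → List Path
pathsOfLength zero    = [] ∷ []
pathsOfLength (suc m) =
  map (right ∷_) (pathsOfLength m) ++ map (up ∷_) (pathsOfLength m)

-- A path from (0,0) to (kn,n) has exactly kn + n unit steps.
minimalBridges : ℕ → ℕ → List Path
minimalBridges k n = filter (isMinimalBridge? k n) (pathsOfLength (k ℕ.* n ℕ.+ n))

b̃ : ℕ → ℕ → ℕ
b̃ k n = length (minimalBridges k n)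

-- b̃ k n is the number of minimal bridges: see ∈-minimalBridges and
-- minimalBridges-unique below.

pathsOfLength-complete : ∀ p → p ∈ pathsOfLength (length p)
pathsOfLength-complete []          = here refl
pathsOfLength-complete (right ∷ p) =
  ∈-++⁺ˡ (∈-map⁺ (right ∷_) (pathsOfLength-complete p))
pathsOfLength-complete (up ∷ p)    =
  ∈-++⁺ʳ (map (right ∷_) (pathsOfLength (length p)))
         (∈-map⁺ (up ∷_) (pathsOfLength-complete p))

pathsOfLength-unique : ∀ m → Unique (pathsOfLength m)
pathsOfLength-unique zero    = All.[] AllPairs.∷ AllPairs.[]
pathsOfLength-unique (suc m) =
  Unique.++⁺ (Unique.map⁺ ∷-injectiveʳ (pathsOfLength-unique m))
             (Unique.map⁺ ∷-injectiveʳ (pathsOfLength-unique m))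
             disjoint
  where
  disjoint : Disjoint (map (right ∷_) (pathsOfLength m))
                      (map (up ∷_) (pathsOfLength m))
  disjoint (p∈ , p∈′) with ∈-map⁻ (right ∷_) p∈ | ∈-map⁻ (up ∷_) p∈′
  ... | _ , _ , refl | _ , _ , ()

endpoint-sum : ∀ P p → let (x′ , y′) = endpoint P p in
               x′ ℕ.+ y′ ≡ length p ℕ.+ (proj₁ P ℕ.+ proj₂ P)
endpoint-sum P             []          = refl
endpoint-sum P@(x , y)     (right ∷ p) =
  trans (endpoint-sum (move P right) p) (ℕ.+-suc (length p) (x ℕ.+ y))
endpoint-sum P@(x , y)     (up ∷ p)    =
  trans (endpoint-sum (move P up) p)
        (trans (cong (length p ℕ.+_) (ℕ.+-suc x y)) (ℕ.+-suc (length p) (x ℕ.+ y)))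

bridge-length : ∀ k n p → IsBridge k n p → length p ≡ k ℕ.* n ℕ.+ n
bridge-length k n p e =
  trans (sym (ℕ.+-identityʳ (length p)))
        (trans (sym (endpoint-sum origin p)) (cong (λ (x , y) → x ℕ.+ y) e))

∈-minimalBridges : ∀ k n p → p ∈ minimalBridges k n ⇔ IsMinimalBridge k n p
∈-minimalBridges k n p = mk⇔
  (λ p∈ → proj₂ (∈-filter⁻ (isMinimalBridge? k n) {xs = pathsOfLength (k ℕ.* n ℕ.+ n)} p∈))
  (λ mb → ∈-filter⁺ (isMinimalBridge? k n)
            (subst (λ m → p ∈ pathsOfLength m)
                   (bridge-length k n p (proj₁ (proj₂ mb)))
                   (pathsOfLength-complete p))
            mb)

minimalBridges-unique : ∀ k n → Unique (minimalBridges k n)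
minimalBridges-unique k n =
  Unique.filter⁺ (isMinimalBridge? k n) (pathsOfLength-unique (k ℕ.* n ℕ.+ n))

-- A formal power series over ℤ is its sequence of coefficients; equality is
-- coefficientwise.
PowerSeries : Set
PowerSeries = ℕ → ℤ

constant : ℤ → PowerSeries
constant c zero    = c
constant c (suc _) = 0ℤ

X : PowerSeries
X 1 = 1ℤ
X _ = 0ℤ

cauchyProduct : PowerSeries → PowerSeries → PowerSeries
cauchyProduct f g n = sum {suc n} (λ i → f (toℕ i) ℤ.* g (n ℕ.∸ toℕ i))
  where open RawMonoidDefinitions ℤ.+-0-rawMonoid using (sum)

powerSeriesRawRing : RawRing 0ℓ 0ℓ
powerSeriesRawRing = record
  { Carrier = PowerSeries
  ; _≈_     = _≗_
  ; _+_     = λ f g n → f n ℤ.+ g n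
  ; _*_     = cauchyProduct
  ; -_      = λ f n → ℤ.- f n
  ; 0#      = constant 0ℤ
  ; 1#      = constant 1ℤ
  }

open RawRing powerSeriesRawRing public using (_≈_; _+_; _*_; -_)
open RawSemiringDefinitions (RawRing.rawSemiring powerSeriesRawRing) public using (_^_)

infixl 6 _-_
_-_ : PowerSeries → PowerSeries → PowerSeries
f - g = f + (- g)

-- The coefficient of x⁰ vanishes because minimal bridges have size at least 1.
B̃ : ℕ → PowerSeries
B̃ k n = + b̃ k n

{-# OPTIONS --safe #-}
module Submission where

-- Call x - k y the height of a point, and let C j be the generating function, by
-- up steps, of the paths climbing from height -j to their first return to
-- height 0.  A height gains only 1 at a time, so C j = T ^ j, where
-- T = 1 + X T ^ (k + 1).  A minimal bridge that starts with an up step climbs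
-- from height -k, which contributes X C k.  One that starts with a right step
-- stays positive until a single up step takes it from a height h in {1, ..., k}
-- to h - k; by reversal the part before that step is counted by C h, the part
-- after it by C (k - h), and so each h contributes X C k as well.  Hence
-- B̃ = (k + 1) X T ^ k.  Since (1 - X T ^ k) T = 1, the factor
-- (k + 1 - B̃) ^ k is (k + 1) ^ k T ^ (- k), and the equation follows.
-- The gluing at h is done by summation by parts against the recurrences of
-- the counts before and after, not by a bijection.

open import Algebra.Bundles using (CommutativeRing)
open import Data.Nat.Base as ℕ using (ℕ; zero; suc; NonZero; _≤_; _<_; z≤n; s≤s)
import Data.Nat.Properties as ℕ

-- Recurrences in an arbitrary commutative ring

module Recurrences {c ℓ} (R : CommutativeRing c ℓ) where

  open CommutativeRing R
  open import Algebra.Properties.CommutativeSemiring.Exp commutativeSemiring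
  open import Algebra.Solver.Ring.NaturalCoefficients.Default commutativeSemiring
    using (solve; _:=_; _:+_; _:*_)
  open import Relation.Binary.Reasoning.Setoid setoid

  ∑ : ℕ → (ℕ → Carrier) → Carrier
  ∑ zero    f = 0#
  ∑ (suc j) f = ∑ j f + f j

  ∑-cong : ∀ {f g} j → (∀ i → i ℕ.< j → f i ≈ g i) → ∑ j f ≈ ∑ j g
  ∑-cong zero    f≈g = refl
  ∑-cong (suc j) f≈g = +-cong (∑-cong j λ i i<j → f≈g i (ℕ.m≤n⇒m≤1+n i<j)) (f≈g j (ℕ.n<1+n j))

  ∑-+ : ∀ f i j → ∑ (i ℕ.+ j) f ≈ ∑ i f + ∑ j (λ l → f (i ℕ.+ l))
  ∑-+ f i zero    rewrite ℕ.+-identityʳ i = sym (+-identityʳ _)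
  ∑-+ f i (suc j) rewrite ℕ.+-suc i j =
    trans (+-congʳ (∑-+ f i j)) (+-assoc _ _ _)

  module _ {x : Carrier} {C M D : ℕ → Carrier} (k : ℕ)
    (C-zero : C 0 ≈ 1#)
    (C-suc  : ∀ j → C (suc j) ≈ C j + x * C (suc j ℕ.+ k))
    (M-suc  : ∀ j → M (suc j) ≈ M (suc (suc j)) + x * D (suc j))
    where

    -- Discrete Leibniz rule: by `C-suc` and `M-suc`, `C j * M (suc j)` changes by
    -- `x * C (suc j + k) * M (suc j)` minus `x * C (suc j) * D (suc j)` when `j` grows by 1, and it
    -- starts at `M 1`.
    summation-by-parts : ∀ j →
      M 1 + ∑ j (λ i → x * (C (suc i ℕ.+ k) * M (suc i)))
        ≈ ∑ j (λ i → x * (C (suc i) * D (suc i))) + C j * M (suc j)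
    summation-by-parts zero    = begin
      M 1 + 0#        ≈⟨ +-comm _ _ ⟩
      0# + M 1        ≈⟨ +-congˡ (*-identityˡ _) ⟨
      0# + 1# * M 1   ≈⟨ +-congˡ (*-congʳ C-zero) ⟨
      0# + C 0 * M 1  ∎
    summation-by-parts (suc j) = begin
      m₁ + (s + x * (c′ * m))              ≈⟨ +-assoc _ _ _ ⟨
      (m₁ + s) + x * (c′ * m)              ≈⟨ +-congʳ (summation-by-parts j) ⟩
      (r + C j * m) + x * (c′ * m)
        ≈⟨ solve 5 (λ r c m x c′ → (r :+ c :* m) :+ x :* (c′ :* m)
                                 := r :+ (c :+ x :* c′) :* m) refl r (C j) m x c′ ⟩
      r + (C j + x * c′) * m               ≈⟨ +-congˡ (*-cong (sym (C-suc j)) (M-suc j)) ⟩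
      r + C (suc j) * (m′ + x * d)
        ≈⟨ solve 5 (λ r c m′ x d → r :+ c :* (m′ :+ x :* d)
                                 := (r :+ x :* (c :* d)) :+ c :* m′) refl r (C (suc j)) m′ x d ⟩
      (r + x * (C (suc j) * d)) + C (suc j) * m′  ∎
      where
      m₁ = M 1
      s  = ∑ j (λ i → x * (C (suc i ℕ.+ k) * M (suc i)))
      r  = ∑ j (λ i → x * (C (suc i) * D (suc i)))
      c′ = C (suc j ℕ.+ k)
      m  = M (suc j)
      m′ = M (suc (suc j))
      d  = D (suc j)

  module _ {x : Carrier} {C : ℕ → Carrier} (k : ℕ)
    (C-zero : C 0 ≈ 1#)
    (C-suc  : ∀ j → C (suc j) ≈ C j + x * C (suc j ℕ.+ k))
    (C-+    : ∀ i j → C (i ℕ.+ j) ≈ C i * C j)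
    where

    private
      -- The inverse of `C 1`, the series T: `V*C` at 0 together with `C-zero` gives `V * C 1 ≈ 1#`.
      V : Carrier
      V = 1# - x * C k

      V*C : ∀ j → V * C (suc j) ≈ C j
      V*C j = begin
        (1# - x * C k) * C (suc j)                ≈⟨ distribʳ _ _ _ ⟩
        1# * C (suc j) + - (x * C k) * C (suc j)  ≈⟨ +-cong (*-identityˡ _) (sym (-‿distribˡ-* _ _)) ⟩
        C (suc j) - x * C k * C (suc j)           ≈⟨ +-cong (C-suc j) (-‿cong x*C*C) ⟩
        C j + x * C (suc j ℕ.+ k) - x * C (suc j ℕ.+ k) ≈⟨ +-assoc _ _ _ ⟩
        C j + (x * C (suc j ℕ.+ k) - x * C (suc j ℕ.+ k)) ≈⟨ +-congˡ (-‿inverseʳ _) ⟩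
        C j + 0#                                  ≈⟨ +-identityʳ _ ⟩
        C j                                       ∎
        where
        open import Algebra.Properties.Ring ring using (-‿distribˡ-*)
        x*C*C : x * C k * C (suc j) ≈ x * C (suc j ℕ.+ k)
        x*C*C = trans (*-assoc _ _ _) (*-congˡ (trans (*-comm _ _) (sym (C-+ (suc j) k))))

      C*V^ : ∀ j → C j * V ^ j ≈ 1#
      C*V^ zero    = trans (*-identityʳ _) C-zero
      C*V^ (suc j) = begin
        C (suc j) * (V * V ^ j)  ≈⟨ *-assoc _ _ _ ⟨
        C (suc j) * V * V ^ j    ≈⟨ *-congʳ (trans (*-comm _ _) (V*C j)) ⟩
        C j * V ^ j              ≈⟨ C*V^ j ⟩
        1#                       ∎

    -- Here `a - B ≈ a * V`, so the power contributes `a ^ k * V ^ k`, and `V ^ k` cancels the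
    -- factor `C k` of `B`.
    algebraic-equation : ∀ {B} a → B ≈ a * (x * C k) → B * (a - B) ^ k ≈ a ^ suc k * x
    algebraic-equation {B} a B≈ = begin
      B * (a - B) ^ k                        ≈⟨ *-cong B≈ (^-congˡ k a-B≈) ⟩
      a * (x * C k) * (a * V) ^ k            ≈⟨ *-congˡ (^-distrib-* a V k) ⟩
      a * (x * C k) * (a ^ k * V ^ k)
        ≈⟨ solve 5 (λ a x c p q → a :* (x :* c) :* (p :* q) := a :* p :* x :* (c :* q))
             refl a x (C k) (a ^ k) (V ^ k) ⟩
      a * a ^ k * x * (C k * V ^ k)          ≈⟨ *-congˡ (C*V^ k) ⟩
      a * a ^ k * x * 1#                     ≈⟨ *-identityʳ _ ⟩
      a ^ suc k * x                          ∎
      where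
      open import Algebra.Properties.Ring ring using (-‿distribʳ-*)
      a-B≈ : a - B ≈ a * V
      a-B≈ = begin
        a - B                          ≈⟨ +-cong (sym (*-identityʳ _)) (-‿cong B≈) ⟩
        a * 1# - a * (x * C k)         ≈⟨ +-congˡ (-‿distribʳ-* _ _) ⟩
        a * 1# + a * - (x * C k)       ≈⟨ distribˡ _ _ _ ⟨
        a * V                          ∎

open import Defs
open import Algebra.Structures _≈_ using (IsAbelianGroup; IsCommutativeRing)
open import Data.Bool.Base using (if_then_else_; true; false)
open import Data.Integer.Base as ℤ using (ℤ; +_; 0ℤ; 1ℤ)
import Data.Integer.Properties as ℤ
open import Algebra.Properties.AbelianGroup ℤ.+-0-abelianGroup using (∙-cancelʳ)
open import Data.Integer.Tactic.RingSolver using (solve-∀)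
open import Data.List.Base using ([]; _∷_; map; filter; length)
open import Data.List.Properties
  using (length-++; filter-++; filter-≐; filter-none; filter-accept)
open import Data.List.Relation.Unary.All as All using (All; []; _∷_)
open import Data.Nat.Solver using (module +-*-Solver)
open import Data.Product.Base using (_×_; _,_; proj₁; proj₂)
open import Data.Sum.Base using (_⊎_; inj₁; inj₂)
open import Function.Base using (_∘_)
open import Level using (0ℓ)
open import Relation.Binary.PropositionalEquality
  using (_≡_; _≢_; _≗_; refl; sym; trans; cong; cong₂; subst; module ≡-Reasoning)
open import Relation.Nullary using (¬_; Dec; yes; no; does; contradiction)
open import Relation.Nullary.Decidable
  using (_×-dec_; _⊎-dec_; _→-dec_; dec-true; dec-false)
open import Relation.Unary using (Pred; Decidable; _≐_)

-- The ring of power series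

tail : PowerSeries → PowerSeries
tail f = f ∘ suc

infixr 7 _•_
_•_ : ℤ → PowerSeries → PowerSeries
(a • f) n = a ℤ.* f n

constant-0 : constant 0ℤ ≗ λ _ → 0ℤ
constant-0 zero    = refl
constant-0 (suc _) = refl

-- `(f * g) (suc n)` unfolds definitionally to `f 0 * g (suc n) + (tail f * g) n`, so this and most
-- product laws below go by induction on the coefficient index.
*-cong : ∀ {f f′ g g′} → f ≈ f′ → g ≈ g′ → f * g ≈ f′ * g′
*-cong f≈ g≈ zero    = cong₂ (λ a b → a ℤ.* b ℤ.+ 0ℤ) (f≈ 0) (g≈ 0)
*-cong f≈ g≈ (suc n) =
  cong₂ ℤ._+_ (cong₂ ℤ._*_ (f≈ 0) (g≈ (suc n))) (*-cong (f≈ ∘ suc) g≈ n)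

zeroSeries-* : ∀ g n → ((λ _ → 0ℤ) * g) n ≡ 0ℤ
zeroSeries-* g zero    = refl
zeroSeries-* g (suc n) = trans (ℤ.+-identityˡ _) (zeroSeries-* g n)

constant-* : ∀ a g → constant a * g ≈ a • g
constant-* a g zero    = ℤ.+-identityʳ _
constant-* a g (suc n) =
  trans (cong (λ z → a ℤ.* g (suc n) ℤ.+ z) (zeroSeries-* g n)) (ℤ.+-identityʳ _)

X-*-suc : ∀ g n → (X * g) (suc n) ≡ g n
X-*-suc g n = trans (ℤ.+-identityˡ _) (trans (*-cong {g = g} tail-X (λ _ → refl) n)
  (trans (constant-* 1ℤ g n) (ℤ.*-identityˡ (g n))))
  where
  tail-X : tail X ≈ constant 1ℤ
  tail-X zero    = refl
  tail-X (suc _) = refl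

•-*-assoc : ∀ a f g → (a • f) * g ≈ a • (f * g)
•-*-assoc a f g zero    = lemma a (f 0) (g 0)
  where
  lemma : ∀ a x y → a ℤ.* x ℤ.* y ℤ.+ 0ℤ ≡ a ℤ.* (x ℤ.* y ℤ.+ 0ℤ)
  lemma = solve-∀
•-*-assoc a f g (suc n) =
  trans (cong (λ z → a ℤ.* f 0 ℤ.* g (suc n) ℤ.+ z) (•-*-assoc a (tail f) g n))
        (lemma a (f 0) (g (suc n)) ((tail f * g) n))
  where
  lemma : ∀ a x y z → a ℤ.* x ℤ.* y ℤ.+ a ℤ.* z ≡ a ℤ.* (x ℤ.* y ℤ.+ z)
  lemma = solve-∀

*-distribʳ-+ : ∀ h f g → (f + g) * h ≈ f * h + g * h
*-distribʳ-+ h f g zero    = lemma (h 0) (f 0) (g 0)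
  where
  lemma : ∀ z x y →
    (x ℤ.+ y) ℤ.* z ℤ.+ 0ℤ ≡ x ℤ.* z ℤ.+ 0ℤ ℤ.+ (y ℤ.* z ℤ.+ 0ℤ)
  lemma = solve-∀
*-distribʳ-+ h f g (suc n) =
  trans (cong (λ z → (f 0 ℤ.+ g 0) ℤ.* h (suc n) ℤ.+ z) (*-distribʳ-+ h (tail f) (tail g) n))
        (lemma (h (suc n)) (f 0) (g 0) ((tail f * h) n) ((tail g * h) n))
  where
  lemma : ∀ z x y u v → (x ℤ.+ y) ℤ.* z ℤ.+ (u ℤ.+ v)
                        ≡ x ℤ.* z ℤ.+ u ℤ.+ (y ℤ.* z ℤ.+ v)
  lemma = solve-∀

-- The mirror image of the definitional unfolding, splitting off the last summand instead of the
-- first; commutativity needs both.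
*-suc-tailʳ : ∀ f g n → (f * g) (suc n) ≡ (f * tail g) n ℤ.+ f (suc n) ℤ.* g 0
*-suc-tailʳ f g zero    = lemma (f 0 ℤ.* g 1) (f 1 ℤ.* g 0)
  where
  lemma : ∀ x y → x ℤ.+ (y ℤ.+ 0ℤ) ≡ x ℤ.+ 0ℤ ℤ.+ y
  lemma = solve-∀
*-suc-tailʳ f g (suc n) =
  trans (cong (λ z → f 0 ℤ.* g (2 ℕ.+ n) ℤ.+ z) (*-suc-tailʳ (tail f) g n))
        (sym (ℤ.+-assoc (f 0 ℤ.* g (2 ℕ.+ n)) ((tail f * tail g) n) (f (2 ℕ.+ n) ℤ.* g 0)))

*-comm : ∀ f g → f * g ≈ g * f
*-comm f g zero    = cong (ℤ._+ 0ℤ) (ℤ.*-comm (f 0) (g 0))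
*-comm f g (suc n) =
  trans (*-suc-tailʳ f g n)
  (trans (ℤ.+-comm ((f * tail g) n) (f (suc n) ℤ.* g 0))
         (cong₂ ℤ._+_ (ℤ.*-comm (f (suc n)) (g 0)) (*-comm f (tail g) n)))

*-assoc : ∀ f g h → (f * g) * h ≈ f * (g * h)
*-assoc f g h zero    = lemma (f 0) (g 0) (h 0)
  where
  lemma : ∀ x y z →
    (x ℤ.* y ℤ.+ 0ℤ) ℤ.* z ℤ.+ 0ℤ ≡ x ℤ.* (y ℤ.* z ℤ.+ 0ℤ) ℤ.+ 0ℤ
  lemma = solve-∀
*-assoc f g h (suc n) =
  trans (cong (λ z → (f 0 ℤ.* g 0 ℤ.+ 0ℤ) ℤ.* h (suc n) ℤ.+ z)
          (trans (*-distribʳ-+ h (f 0 • tail g) (tail f * g) n)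
                 (cong₂ ℤ._+_ (•-*-assoc (f 0) (tail g) h n)
                              (*-assoc (tail f) g h n))))
        (lemma (f 0) (g 0) (h (suc n)) ((tail g * h) n) ((tail f * (g * h)) n))
  where
  lemma : ∀ x y z u v → (x ℤ.* y ℤ.+ 0ℤ) ℤ.* z ℤ.+ (x ℤ.* u ℤ.+ v)
                        ≡ x ℤ.* (y ℤ.* z ℤ.+ u) ℤ.+ v
  lemma = solve-∀

*-identityˡ : ∀ f → constant 1ℤ * f ≈ f
*-identityˡ f n = trans (constant-* 1ℤ f n) (ℤ.*-identityˡ (f n))

+-isAbelianGroup : IsAbelianGroup _+_ (constant 0ℤ) (-_)
+-isAbelianGroup = record
  { isGroup = record
    { isMonoid = record
      { isSemigroup = record
        { isMagma = record
          { isEquivalence = record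
            { refl  = λ _ → refl
            ; sym   = λ f≈g n → sym (f≈g n)
            ; trans = λ f≈g g≈h n → trans (f≈g n) (g≈h n)
            }
          ; ∙-cong = λ f≈ g≈ n → cong₂ ℤ._+_ (f≈ n) (g≈ n)
          }
        ; assoc = λ f g h n → ℤ.+-assoc (f n) (g n) (h n)
        }
      ; identity =
          (λ f n → trans (cong (ℤ._+ f n) (constant-0 n)) (ℤ.+-identityˡ (f n)))
        , (λ f n → trans (cong (λ z → f n ℤ.+ z) (constant-0 n)) (ℤ.+-identityʳ (f n)))
      }
    ; inverse =
        (λ f n → trans (ℤ.+-inverseˡ (f n)) (sym (constant-0 n)))
      , (λ f n → trans (ℤ.+-inverseʳ (f n)) (sym (constant-0 n)))
    ; ⁻¹-cong = λ f≈g n → cong ℤ.-_ (f≈g n)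
    }
  ; comm = λ f g n → ℤ.+-comm (f n) (g n)
  }

isCommutativeRing : IsCommutativeRing _+_ _*_ (-_) (constant 0ℤ) (constant 1ℤ)
isCommutativeRing = record
  { isRing = record
    { +-isAbelianGroup = +-isAbelianGroup
    ; *-cong           = *-cong
    ; *-assoc          = *-assoc
    ; *-identity       =
        *-identityˡ , λ f n → trans (*-comm f (constant 1ℤ) n) (*-identityˡ f n)
    ; distrib          =
        (λ f g h n → trans (*-comm f (g + h) n) (trans (*-distribʳ-+ f g h n)
                       (cong₂ ℤ._+_ (*-comm g f n) (*-comm h f n))))
      , *-distribʳ-+
    }
  ; *-comm = *-comm
  }

powerSeriesRing : CommutativeRing 0ℓ 0ℓ
powerSeriesRing = record { isCommutativeRing = isCommutativeRing }

open Recurrences powerSeriesRing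

-- Only coefficients of `g` up to `n` enter, so this applies to series such as `M h` that vanish
-- just to a finite order.
*-vanish : ∀ f {g} n → (∀ i → i ≤ n → g i ≡ 0ℤ) → (f * g) n ≡ 0ℤ
*-vanish f {g} zero    g≡0 =
  trans (ℤ.+-identityʳ _) (trans (cong (f 0 ℤ.*_) (g≡0 0 z≤n)) (ℤ.*-zeroʳ (f 0)))
*-vanish f {g} (suc n) g≡0 = cong₂ ℤ._+_
  (trans (cong (f 0 ℤ.*_) (g≡0 (suc n) ℕ.≤-refl)) (ℤ.*-zeroʳ (f 0)))
  (*-vanish (tail f) n λ i i≤n → g≡0 i (ℕ.m≤n⇒m≤1+n i≤n))

∑-vanish : ∀ j {f : ℕ → PowerSeries} n → (∀ i → f i n ≡ 0ℤ) → ∑ j f n ≡ 0ℤ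
∑-vanish zero    n f≡0 = constant-0 n
∑-vanish (suc j) n f≡0 = cong₂ ℤ._+_ (∑-vanish j n f≡0) (f≡0 j)

∑-const : ∀ j f → ∑ j (λ _ → f) ≈ constant (+ j) * f
∑-const j f n = trans (lemma j) (sym (constant-* (+ j) f n))
  where
  lemma : ∀ j → ∑ j (λ _ → f) n ≡ + j ℤ.* f n
  lemma zero    = constant-0 n
  lemma (suc j) = trans (cong (λ z → z ℤ.+ f n) (lemma j))
    (trans (ℤ.+-comm (+ j ℤ.* f n) (f n)) (sym (ℤ.suc-* (+ j) (f n))))

constant-^ : ∀ m j → constant (+ m) ^ j ≈ constant (+ (m ℕ.^ j))
constant-^ m zero    _ = refl
constant-^ m (suc j) n =
  trans (*-cong {f = constant (+ m)} (λ _ → refl) (constant-^ m j) n)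
        (trans (constant-* (+ m) (constant (+ (m ℕ.^ j))) n) (lemma n))
  where
  lemma : (+ m) • constant (+ (m ℕ.^ j)) ≈ constant (+ (m ℕ.^ suc j))
  lemma zero    = sym (ℤ.pos-* m (m ℕ.^ j))
  lemma (suc _) = ℤ.*-zeroʳ (+ m)

-- Counting paths

length-filter-map : ∀ {A B : Set} {P : Pred B 0ℓ} (P? : Decidable P) (f : A → B) xs →
  length (filter P? (map f xs)) ≡ length (filter (P? ∘ f) xs)
length-filter-map P? f []       = refl
length-filter-map P? f (x ∷ xs) with does (P? (f x))
... | true  = cong suc (length-filter-map P? f xs)
... | false = length-filter-map P? f xs

count : ∀ {Q : Pred Path 0ℓ} → Decidable Q → ℕ → ℕ
count Q? m = length (filter Q? (pathsOfLength m))

count-cong : ∀ {Q R : Pred Path 0ℓ} (Q? : Decidable Q) (R? : Decidable R) → Q ≐ R →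
  ∀ m → count Q? m ≡ count R? m
count-cong Q? R? Q≐R m = cong length (filter-≐ Q? R? Q≐R (pathsOfLength m))

count-none : ∀ {Q : Pred Path 0ℓ} (Q? : Decidable Q) → (∀ p → ¬ Q p) → ∀ m → count Q? m ≡ 0
count-none Q? ¬Q m = cong length (filter-none Q? (All.universal ¬Q (pathsOfLength m)))

count-suc : ∀ {Q : Pred Path 0ℓ} (Q? : Decidable Q) m →
  count Q? (suc m) ≡ count (Q? ∘ (right ∷_)) m ℕ.+ count (Q? ∘ (up ∷_)) m
count-suc Q? m = trans (cong length (filter-++ Q? (map (right ∷_) ps) (map (up ∷_) ps)))
  (trans (length-++ (filter Q? (map (right ∷_) ps)))
         (cong₂ ℕ._+_ (length-filter-map Q? (right ∷_) ps) (length-filter-map Q? (up ∷_) ps)))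
  where ps = pathsOfLength m

endpoint-≥ˣ : ∀ x y p → x ≤ proj₁ (endpoint (x , y) p)
endpoint-≥ˣ x y []          = ℕ.≤-refl
endpoint-≥ˣ x y (right ∷ p) = ℕ.≤-trans (ℕ.n≤1+n x) (endpoint-≥ˣ (suc x) y p)
endpoint-≥ˣ x y (up ∷ p)    = endpoint-≥ˣ x (suc y) p

endpoint-≥ʸ : ∀ x y p → y ≤ proj₂ (endpoint (x , y) p)
endpoint-≥ʸ x y []          = ℕ.≤-refl
endpoint-≥ʸ x y (right ∷ p) = endpoint-≥ʸ (suc x) y p
endpoint-≥ʸ x y (up ∷ p)    = ℕ.≤-trans (ℕ.n≤1+n y) (endpoint-≥ʸ x (suc y) p)

-- A point other than the origin is recorded by the numbers r and n of right and
-- up steps still needed to reach the target; it is on the line iff r = k n.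
completions : ℕ → ℕ → ℕ → ℕ
completions k zero    zero    = 1
completions k zero    (suc n) = completions k zero n
completions k (suc r) zero    = completions k r zero
completions k (suc r) (suc n) =
  if does (suc r ℕ.≟ k ℕ.* suc n) then 0
  else completions k r (suc n) ℕ.+ completions k (suc r) n

completions-offLine : ∀ k r n → suc r ≢ k ℕ.* suc n →
  completions k (suc r) (suc n) ≡ completions k r (suc n) ℕ.+ completions k (suc r) n
completions-offLine k r n r≢ rewrite dec-false (suc r ℕ.≟ k ℕ.* suc n) r≢ = refl

module _ (k : ℕ) .{{_ : NonZero k}} where

  k*suc≢0 : ∀ n → k ℕ.* suc n ≢ 0
  k*suc≢0 n = ℕ.≢-nonZero⁻¹ (k ℕ.* suc n) {{ℕ.m*n≢0 k (suc n)}}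

  completions-onLine : ∀ r n → r ≡ k ℕ.* suc n → completions k r (suc n) ≡ 0
  completions-onLine zero    n on = contradiction (sym on) (k*suc≢0 n)
  completions-onLine (suc r) n on rewrite dec-true (suc r ℕ.≟ k ℕ.* suc n) on = refl

  module _ (N : ℕ) where

    Allowed : Point → Set
    Allowed P = OnLine k P → P ≡ origin ⊎ P ≡ target k N

    -- The version of a minimal bridge for suffixes of paths: from `origin` it is
    -- `IsMinimalBridge k N` without the size condition.
    Completes : Point → Path → Set
    Completes P p = endpoint P p ≡ target k N × All Allowed (points P p)

    completes? : ∀ P → Decidable (Completes P)
    completes? P p = endpoint P p ≟ᴾ target k N ×-dec
      All.all? (λ (x , y) → x ℕ.≟ k ℕ.* y →-dec
                 ((x , y) ≟ᴾ origin ⊎-dec (x , y) ≟ᴾ target k N))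
               (points P p)

    allowed-head : ∀ {P} p → Completes P p → Allowed P
    allowed-head []      (_ , a ∷ _) = a
    allowed-head (_ ∷ _) (_ , a ∷ _) = a

    count-move : ∀ {P} → Allowed P → ∀ s m →
      count (completes? P ∘ (s ∷_)) m ≡ count (completes? (move P s)) m
    count-move a s = count-cong _ _
      ((λ { (e , _ ∷ as) → e , as }) , (λ { (e , as) → e , a ∷ as }))

    count-steps : ∀ {P} → Allowed P → ∀ m → count (completes? P) (suc m)
      ≡ count (completes? (move P right)) m ℕ.+ count (completes? (move P up)) m
    count-steps a m = trans (count-suc _ m) (cong₂ ℕ._+_ (count-move a right m) (count-move a up m))

    count-overshootˣ : ∀ x y → k ℕ.* N < x → ∀ m → count (completes? (x , y)) m ≡ 0
    count-overshootˣ x y kN<x = count-none _ λ p (e , _) →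
      ℕ.<⇒≱ kN<x (subst (x ≤_) (cong proj₁ e) (endpoint-≥ˣ x y p))

    count-overshootʸ : ∀ x y → N < y → ∀ m → count (completes? (x , y)) m ≡ 0
    count-overshootʸ x y N<y = count-none _ λ p (e , _) →
      ℕ.<⇒≱ N<y (subst (y ≤_) (cong proj₂ e) (endpoint-≥ʸ x y p))

    onLine⇒ : ∀ {x y r n} → x ℕ.+ r ≡ k ℕ.* N → y ℕ.+ n ≡ N → x ≡ k ℕ.* y → r ≡ k ℕ.* n
    onLine⇒ {x} {y} {r} {n} ex refl refl =
      ℕ.+-cancelˡ-≡ (k ℕ.* y) r (k ℕ.* n) (trans ex (ℕ.*-distribˡ-+ k y n))

    onLine⇐ : ∀ {x y r n} → x ℕ.+ r ≡ k ℕ.* N → y ℕ.+ n ≡ N → r ≡ k ℕ.* n → x ≡ k ℕ.* y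
    onLine⇐ {x} {y} {r} {n} ex refl refl =
      ℕ.+-cancelʳ-≡ (k ℕ.* n) x (k ℕ.* y) (trans ex (ℕ.*-distribˡ-+ k y n))

    -- Induction on the remaining steps: a step overshooting the target contributes 0, as does a
    -- start on the line short of the target. The origin is excluded because paths may start there,
    -- whereas for `N ≥ 1` `completions` is 0 at it.
    count-completes : ∀ r n x y → x ℕ.+ r ≡ k ℕ.* N → y ℕ.+ n ≡ N → (x , y) ≢ origin →
      count (completes? (x , y)) (r ℕ.+ n) ≡ completions k r n
    count-completes zero zero x y ex ey _ =
      cong length (filter-accept (completes? (x , y)) {[]} {[]}
                                 (at-target , (λ _ → inj₂ at-target) ∷ []))
      where
      at-target : (x , y) ≡ target k N
      at-target = cong₂ _,_ (trans (sym (ℕ.+-identityʳ x)) ex) (trans (sym (ℕ.+-identityʳ y)) ey)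
    count-completes zero (suc n) x y ex ey P≢ =
      trans (count-steps (λ on → contradiction (sym (onLine⇒ ex ey on)) (k*suc≢0 n)) n)
            (cong₂ ℕ._+_ (count-overshootˣ (suc x) y kN<1+x n)
                         (count-completes zero n x (suc y) ex (trans (sym (ℕ.+-suc y n)) ey) λ ()))
      where
      kN<1+x : k ℕ.* N < suc x
      kN<1+x = s≤s (ℕ.≤-reflexive (trans (sym ex) (ℕ.+-identityʳ x)))
    count-completes (suc r) zero x y ex ey P≢ =
      trans (count-steps (λ on → contradiction (trans (onLine⇒ ex ey on) (ℕ.*-zeroʳ k)) λ ())
                         (r ℕ.+ 0))
      (trans (cong₂ ℕ._+_
               (count-completes r zero (suc x) y (trans (sym (ℕ.+-suc x r)) ex) ey λ ())
               (count-overshootʸ x (suc y) N<1+y (r ℕ.+ 0)))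
             (ℕ.+-identityʳ _))
      where
      N<1+y : N < suc y
      N<1+y = s≤s (ℕ.≤-reflexive (trans (sym ey) (ℕ.+-identityʳ y)))
    count-completes (suc r) (suc n) x y ex ey P≢ = split (suc r ℕ.≟ k ℕ.* suc n)
      where
      not-target : (x , y) ≢ target k N
      not-target refl = ℕ.m≢1+m+n N (sym (trans (sym (ℕ.+-suc N n)) ey))
      not-allowed : suc r ≡ k ℕ.* suc n → ∀ p → ¬ Completes (x , y) p
      not-allowed on p c with allowed-head p c (onLine⇐ ex ey on)
      ... | inj₁ P≡ = P≢ P≡
      ... | inj₂ P≡ = not-target P≡
      split : Dec (suc r ≡ k ℕ.* suc n) →
        count (completes? (x , y)) (suc r ℕ.+ suc n) ≡ completions k (suc r) (suc n)
      split (yes on) = trans (count-none _ (not-allowed on) (suc r ℕ.+ suc n))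
                             (sym (completions-onLine (suc r) n on))
      split (no off) = trans
        (count-steps (λ on → contradiction (onLine⇒ ex ey on) off) (r ℕ.+ suc n))
        (trans
          (cong₂ ℕ._+_
            (count-completes r (suc n) (suc x) y (trans (sym (ℕ.+-suc x r)) ex) ey λ ())
            (trans (cong (count (completes? (x , suc y))) (ℕ.+-suc r n))
                   (count-completes (suc r) n x (suc y) ex (trans (sym (ℕ.+-suc y n)) ey) λ ())))
          (sym (completions-offLine k r n off)))

  b̃-zero : b̃ k 0 ≡ 0
  b̃-zero = count-none (isMinimalBridge? k 0) (λ _ ()) (k ℕ.* 0 ℕ.+ 0)

  -- The origin is exempt from the line condition, so the first step is split off separately and
  -- `count-completes` applies after it.
  b̃-suc : ∀ n r → suc r ≡ k ℕ.* suc n →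
    b̃ k (suc n) ≡ completions k r (suc n) ℕ.+ completions k (suc r) n
  b̃-suc n r eq = begin
    b̃ k N
      ≡⟨ count-cong _ (completes? N origin) (proj₂ , (s≤s z≤n ,_)) (k ℕ.* N ℕ.+ N) ⟩
    count (completes? N origin) (k ℕ.* N ℕ.+ N)
      ≡⟨ cong (λ l → count (completes? N origin) (l ℕ.+ N)) (sym eq) ⟩
    count (completes? N origin) (suc (r ℕ.+ N))
      ≡⟨ count-steps N (λ _ → inj₁ refl) (r ℕ.+ N) ⟩
    count (completes? N (1 , 0)) (r ℕ.+ N) ℕ.+ count (completes? N (0 , 1)) (r ℕ.+ N)
      ≡⟨ cong₂ ℕ._+_
           (count-completes N r N 1 0 eq refl λ ())
           (trans (cong (count (completes? N (0 , 1))) (ℕ.+-suc r n))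
                  (count-completes N (suc r) n 0 1 eq refl λ ())) ⟩
    completions k r N ℕ.+ completions k (suc r) n  ∎
    where
    open ≡-Reasoning
    N = suc n

-- Generating functions

shift : (ℕ → ℕ) → ℕ → ℕ → ℕ
shift f a       zero    = f a
shift f zero    (suc h) = 0
shift f (suc a) (suc h) = shift f a h

shift-+ : ∀ f k a h → shift f (k ℕ.+ a) (k ℕ.+ h) ≡ shift f a h
shift-+ f zero    a h = refl
shift-+ f (suc k) a h = shift-+ f k a h

shift-vanish : ∀ f {a h} → a < h → shift f a h ≡ 0
shift-vanish f {zero}  {suc h} _         = refl
shift-vanish f {suc a} {suc h} (s≤s a<h) = shift-vanish f a<h

-- For `h < a` this is the hypothesis on `f` at `r = a - h - 1`; at `h = a` the term in `suc h` is 0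
-- and `f 0 ≡ g 0` serves; for `h > a` every term is 0.
shift-rec : ∀ {f g : ℕ → ℕ} → f 0 ≡ g 0 → ∀ a h →
  (∀ r → suc r ≤ a → f (suc r) ≡ f r ℕ.+ g (suc r)) →
  shift f a h ≡ shift f a (suc h) ℕ.+ shift g a h
shift-rec f0 zero    zero    step = f0
shift-rec f0 zero    (suc h) step = refl
shift-rec f0 (suc a) zero    step = step a ℕ.≤-refl
shift-rec f0 (suc a) (suc h) step = shift-rec f0 a h λ r r<a → step r (ℕ.m≤n⇒m≤1+n r<a)

module _ (k : ℕ) .{{_ : NonZero k}} where

  -- A path at height h = x - k y with n up steps to go still needs
  -- k n - h right steps.  So C j counts completions from height -j, D a from
  -- height a - k and M h from height h; shift makes a count 0, rather than a
  -- value at truncated subtraction, when the number of right steps is negative.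
  C : ℕ → PowerSeries
  C j n = + completions k (j ℕ.+ k ℕ.* n) n

  D : ℕ → PowerSeries
  D a n = + shift (λ r → completions k r n) (k ℕ.+ k ℕ.* n) a

  M : ℕ → PowerSeries
  M h = D (k ℕ.+ h)

  -- With no up steps left the start is the target; otherwise it is a forbidden point of the line.
  C-zero : C 0 ≈ constant 1ℤ
  C-zero zero    rewrite ℕ.*-zeroʳ k = refl
  C-zero (suc n) = cong +_ (completions-onLine k _ n refl)

  -- From height `- suc j` a right step leads to `- j` and an up step, marked by `X`, to
  -- `- (suc j + k)`.
  C-suc : ∀ j → C (suc j) ≈ C j + X * C (suc j ℕ.+ k)
  C-suc j zero    = sym (ℤ.+-identityʳ _)
  C-suc j (suc n) = trans (cong +_ rec) (cong (λ z → C j (suc n) ℤ.+ z)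
    (trans (cong (λ i → + completions k i n) index) (sym (X-*-suc (C (suc j ℕ.+ k)) n))))
    where
    rec = completions-offLine k (j ℕ.+ k ℕ.* suc n) n
            (λ e → ℕ.m≢1+n+m (k ℕ.* suc n) (sym e))
    index : suc j ℕ.+ k ℕ.* suc n ≡ suc j ℕ.+ k ℕ.+ k ℕ.* n
    index = solve 3 (λ j k n → con 1 :+ j :+ k :* (con 1 :+ n)
                               := con 1 :+ j :+ k :+ k :* n) refl j k n
      where open +-*-Solver

  -- Both sides satisfy the recurrence C-suc in i, which determines the
  -- coefficients by induction on (n , i).
  C-+ : ∀ i j → C (i ℕ.+ j) ≈ C i * C j
  C-+ i j n = lemma n i
    where
    lemma : ∀ n i → C (i ℕ.+ j) n ≡ (C i * C j) n
    lemma n zero    = sym (trans (*-cong {g = C j} C-zero (λ _ → refl) n) (*-identityˡ (C j) n))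
    lemma n (suc i) = begin
      C (suc i ℕ.+ j) n
        ≡⟨ C-suc (i ℕ.+ j) n ⟩
      C (i ℕ.+ j) n ℤ.+ (X * C (suc (i ℕ.+ j) ℕ.+ k)) n
        ≡⟨ cong₂ ℤ._+_ (lemma n i) (X-lemma n) ⟩
      (C i * C j) n ℤ.+ (X * (C (suc i ℕ.+ k) * C j)) n
        ≡⟨ cong (λ z → (C i * C j) n ℤ.+ z) (*-assoc X (C (suc i ℕ.+ k)) (C j) n) ⟨
      (C i * C j) n ℤ.+ ((X * C (suc i ℕ.+ k)) * C j) n
        ≡⟨ *-distribʳ-+ (C j) (C i) (X * C (suc i ℕ.+ k)) n ⟨
      ((C i + X * C (suc i ℕ.+ k)) * C j) n
        ≡⟨ *-cong {g = C j} (C-suc i) (λ _ → refl) n ⟨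
      (C (suc i) * C j) n ∎
      where
      open ≡-Reasoning
      index : suc (i ℕ.+ j) ℕ.+ k ≡ suc i ℕ.+ k ℕ.+ j
      index = solve 3 (λ i j k → con 1 :+ (i :+ j) :+ k := con 1 :+ i :+ k :+ j) refl i j k
        where open +-*-Solver
      -- The factor `X` lowers the coefficient index, which permits the induction hypothesis at the
      -- larger index `suc i + k`.
      X-lemma : ∀ n → (X * C (suc (i ℕ.+ j) ℕ.+ k)) n ≡ (X * (C (suc i ℕ.+ k) * C j)) n
      X-lemma zero    = refl
      X-lemma (suc n) = trans (X-*-suc (C (suc (i ℕ.+ j) ℕ.+ k)) n)
        (trans (cong (λ l → C l n) index)
        (trans (lemma n (suc i ℕ.+ k)) (sym (X-*-suc (C (suc i ℕ.+ k) * C j) n))))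

  -- From height `suc j` a right step leads to `suc (suc j)` and an up step to `suc j - k`, the
  -- start counted by `D (suc j)`.
  M-suc : ∀ j → M (suc j) ≈ M (suc (suc j)) + X * D (suc j)
  M-suc j zero
    rewrite shift-+ (λ r → completions k r 0) k (k ℕ.* 0) (suc j)
          | shift-+ (λ r → completions k r 0) k (k ℕ.* 0) (suc (suc j))
          | ℕ.*-zeroʳ k = refl
  M-suc j (suc n) = begin
    + shift f (k ℕ.+ k ℕ.* suc n) (k ℕ.+ suc j)
      ≡⟨ cong +_ (shift-+ f k (k ℕ.* suc n) (suc j)) ⟩
    + shift f (k ℕ.* suc n) (suc j)
      ≡⟨ cong +_ (rec (k ℕ.* suc n) ℕ.≤-refl) ⟩
    + shift f (k ℕ.* suc n) (suc (suc j)) ℤ.+ + shift g (k ℕ.* suc n) (suc j)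
      ≡⟨ cong₂ (λ a b → + a ℤ.+ + shift g b (suc j))
           (sym (shift-+ f k (k ℕ.* suc n) (suc (suc j)))) (ℕ.*-suc k n) ⟩
    M (suc (suc j)) (suc n) ℤ.+ D (suc j) n
      ≡⟨ cong (λ z → M (suc (suc j)) (suc n) ℤ.+ z) (X-*-suc (D (suc j)) n) ⟨
    M (suc (suc j)) (suc n) ℤ.+ (X * D (suc j)) (suc n) ∎
    where
    open ≡-Reasoning
    f g : ℕ → ℕ
    f r = completions k r (suc n)
    g r = completions k r n
    rec : ∀ a → a ≤ k ℕ.* suc n →
      shift f a (suc j) ≡ shift f a (suc (suc j)) ℕ.+ shift g a (suc j)
    rec zero    _  = refl
    -- The height is positive: removing one unit of it leaves `suc r ≤ a`, strictly below
    -- `k * suc n` and so off the line.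
    rec (suc a) a< = shift-rec refl a j λ r r<a →
      completions-offLine k r n (ℕ.<⇒≢ (ℕ.≤-<-trans r<a a<))

  D-≤ : ∀ a j → a ℕ.+ j ≡ k → D a ≈ C j
  D-≤ a j refl n = cong +_ (trans
    (cong₂ (shift f) (ℕ.+-assoc a j (k ℕ.* n)) (sym (ℕ.+-identityʳ a)))
    (shift-+ f a (j ℕ.+ k ℕ.* n) 0))
    where f = λ r → completions k r n

  -- With `i` up steps to go, height `h` would need `k * i - h` right steps, a negative number.
  M-vanish : ∀ {N h} → k ℕ.* N < h → ∀ i → i ≤ N → M h i ≡ 0ℤ
  M-vanish {N} {h} kN<h i i≤N = cong +_ (trans (shift-+ _ k (k ℕ.* i) h)
    (shift-vanish _ (ℕ.≤-<-trans (ℕ.*-monoʳ-≤ k i≤N) kN<h)))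

  -- At x^N every M h with h > k N vanishes, so the identity summed up to
  -- h = k N + k loses its boundary term; the terms of the sums with h > k on
  -- one side match those of the other, leaving C h C (k - h) = C k for 1 ≤ h ≤ k.
  M-1 : M 1 ≈ ∑ k (λ _ → X * C k)
  M-1 N = cancel (trans (sym (cong (λ z → M 1 N ℤ.+ z) split-s))
    (trans (summation-by-parts {X} {C} {M} {D} k C-zero C-suc M-suc (j ℕ.+ k) N)
           (cong₂ ℤ._+_ split-r rest)))
    where
    j = k ℕ.* N
    s r : ℕ → PowerSeries
    s i = X * (C (suc i ℕ.+ k) * M (suc i))
    r i = X * (C (suc i) * D (suc i))

    rest : (C (j ℕ.+ k) * M (suc (j ℕ.+ k))) N ≡ 0ℤ
    rest = *-vanish (C (j ℕ.+ k)) N (M-vanish (s≤s (ℕ.m≤m+n j k)))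

    split-s : ∑ (j ℕ.+ k) s N ≡ ∑ j s N ℤ.+ 0ℤ
    split-s = trans (∑-+ s j k N) (cong (λ z → ∑ j s N ℤ.+ z) (∑-vanish k N λ i →
      *-vanish X N λ l l≤N → *-vanish (C (suc (j ℕ.+ i) ℕ.+ k)) l λ m m≤l →
        M-vanish (s≤s (ℕ.m≤m+n j i)) m (ℕ.≤-trans m≤l l≤N)))

    r-low : ∀ i → i < k → r i ≈ X * C k
    r-low i i<k = *-cong {f = X} (λ _ → refl) λ n →
      trans (*-cong {f = C (suc i)} (λ _ → refl) (D-≤ (suc i) (k ℕ.∸ suc i) (ℕ.m+[n∸m]≡n i<k)) n)
      (trans (sym (C-+ (suc i) (k ℕ.∸ suc i) n)) (cong (λ l → C l n) (ℕ.m+[n∸m]≡n i<k)))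

    -- `D (k + suc i)` is `M (suc i)` by definition, so moving the index by `k` turns one sum into
    -- the other.
    r-high : ∀ i → r (k ℕ.+ i) ≈ s i
    r-high i n = cong₂ (λ a b → (X * (C a * D b)) n)
      (cong suc (ℕ.+-comm k i)) (sym (ℕ.+-suc k i))

    split-r : ∑ (j ℕ.+ k) r N ≡ ∑ k (λ _ → X * C k) N ℤ.+ ∑ j s N
    split-r = trans (cong (λ l → ∑ l r N) (ℕ.+-comm j k)) (trans (∑-+ r k j N)
      (cong₂ ℤ._+_ (∑-cong k r-low N) (∑-cong j (λ i _ → r-high i) N)))

    cancel : ∀ {a b c} → a ℤ.+ (b ℤ.+ 0ℤ) ≡ c ℤ.+ b ℤ.+ 0ℤ → a ≡ c
    cancel {a} {b} {c} e = ∙-cancelʳ b a c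
      (trans (cong (λ z → a ℤ.+ z) (sym (ℤ.+-identityʳ b))) (trans e (ℤ.+-identityʳ (c ℤ.+ b))))

  -- Minimal bridges and the algebraic equation

  -- `M 1` collects the bridges starting with a right step, `X * C k` those starting with an up
  -- step.
  B̃-decomposition : B̃ k ≈ M 1 + X * C k
  B̃-decomposition zero = trans (cong +_ (b̃-zero k))
    (sym (trans (ℤ.+-identityʳ _) (M-vanish (s≤s (ℕ.≤-reflexive (ℕ.*-zeroʳ k))) 0 z≤n)))
  B̃-decomposition (suc n) = trans (cong +_ (lemma (k ℕ.* suc n) refl))
    (cong₂ ℤ._+_ (cong +_ (sym (shift-+ f k (k ℕ.* suc n) 1))) (sym (X-*-suc (C k) n)))
    where
    f : ℕ → ℕ
    f r = completions k r (suc n)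
    lemma : ∀ r → r ≡ k ℕ.* suc n →
      b̃ k (suc n) ≡ shift f (k ℕ.* suc n) 1 ℕ.+ completions k (k ℕ.+ k ℕ.* n) n
    lemma zero    e = contradiction (sym e) (k*suc≢0 k n)
    lemma (suc r) e = trans (b̃-suc k n r e) (cong₂ ℕ._+_
      (cong (λ l → shift f l 1) e)
      (cong (λ l → completions k l n) (trans e (ℕ.*-suc k n))))

  B̃≈ : B̃ k ≈ constant (+ (k ℕ.+ 1)) * (X * C k)
  B̃≈ n = trans (B̃-decomposition n)
    (trans (cong (λ z → z ℤ.+ (X * C k) n) (M-1 n))
    (trans (∑-const (suc k) (X * C k) n)
           (cong (λ l → (constant (+ l) * (X * C k)) n) (ℕ.+-comm 1 k))))

corollary14 : (k : ℕ) → .{{_ : NonZero k}} →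
    B̃ k * (constant (+ (k ℕ.+ 1)) - B̃ k) ^ k
    ≈ constant (+ ((k ℕ.+ 1) ℕ.^ (k ℕ.+ 1))) * X
corollary14 k n =
  trans (algebraic-equation {X} {C k} k (C-zero k) (C-suc k) (C-+ k) (constant (+ (k ℕ.+ 1))) (B̃≈ k) n)
        (*-cong {g = X} (λ i → trans (constant-^ (k ℕ.+ 1) (suc k) i)
           (cong (λ l → constant (+ ((k ℕ.+ 1) ℕ.^ l)) i) (ℕ.+-comm 1 k))) (λ _ → refl) n)
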